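{- Over any finite alphabet $A$, the logics $\mathrm{TL}[\mathrm{Th}]$, $\mathrm{TL}[\mathrm{BTh}]$, $\mathrm{TL}[\mathrm{Inv}]$, $\mathrm{TL}[\mathrm{BInv}]$, $FO^2[<,\mathrm{Th}]$ and $FO^2[<,\mathrm{Inv}]$ all define the same family of languages $L\subseteq A^*$.
   Context: Words $w\in A^*$ have positions $1,\dots,|w|$, $w(i)$ the $i$-th letter. First-order logic uses $<$ and unary predicates $a(x)$ ($a\in A$); sentences define languages, and in the empty word existential sentences are false and universal ones true. $a(x,y)$ abbreviates $\exists z(x<z\wedge z<y\wedge a(z))$; $(a,k)(x,y)$ (for $k\ge0$) means $x<y$ and at least $k$ positions strictly between $x$ and $y$ carry the letter $a$. $FO^2[<,\mathrm{Inv}]$ is the two-variable logic with $<$, $a(x)$ and $a(x,y)$; $FO^2[<,\mathrm{Th}]$ is the two-variable logic with $<$, $a(x)$ and all $(a,k)(x,y)$. Temporal logic: a threshold constraint is an expression $\#B\sim c$ with $B\subseteq A$, integer $c\ge0$, and $\sim\in\{<,\le,>,\ge,=\}$; for $1\le i<j\le|w|$, $(w,i,j)$ satisfies it if $|\{k: i<k<j,\ w(k)\in B\}|\sim c$; satisfaction extends to boolean combinations of constraints in the obvious way. Temporal formulas are built from atomic formulas $a\in A$ by $\wedge,\vee,\neg$ and modalities $\mathsf{F}_g\phi$, $\mathsf{P}_g\phi$ where $g$ is a (boolean combination of) constraint(s). They are interpreted in marked words $(w,i)$, $1\le i\le|w|$: $(w,i)\models a$ iff $w(i)=a$; $(w,i)\models\mathsf{F}_g\phi$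 iff there is $j>i$ with $(w,i,j)$ satisfying $g$ and $(w,j)\models\phi$; $(w,i)\models\mathsf{P}_g\phi$ iff there is $j<i$ with $(w,j,i)$ satisfying $g$ and $(w,j)\models\phi$. A formula defines the language of words $w$ with $(w,1)\models\phi$. $\mathrm{TL}[\mathrm{BTh}]$ allows $g$ to be any boolean combination of threshold constraints; $\mathrm{TL}[\mathrm{Th}]$ restricts $g$ to a single (atomic) threshold constraint; $\mathrm{TL}[\mathrm{Inv}]$ restricts $g$ to a single constraint of the form $\#B=0$ (invariant constraint); $\mathrm{TL}[\mathrm{BInv}]$ allows boolean combinations of invariant constraints. -}

module Defs where

open import Data.Fin using (Fin)
import Data.Fin.Properties as Fin
open import Data.Fin.Subset using (Subset; _∈_)
open import Data.Fin.Subset.Properties using (_∈?_)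
open import Data.List using (List; length; drop; head; filter; upTo)
open import Data.Maybe using (Maybe; just)
open import Data.Maybe.Relation.Unary.Any as Maybe using (Any)
open import Data.Nat using (ℕ; _≤_; _<_; _≥_; _>_; _<?_)
open import Data.Product using (Σ-syntax; ∃-syntax; _×_; _,_)
open import Data.Sum using (_⊎_)
open import Data.Unit using () renaming (⊤ to Unit)
open import Data.Vec.Functional using (Vector; updateAt)
open import Function using (const)
open import Level using (0ℓ)
open import Relation.Binary.PropositionalEquality using (_≡_; _≢_)
open import Relation.Nullary using (¬_; _×-dec_)
open import Relation.Unary using (Pred; Decidable; Empty; _≐_)

Word : ℕ → Set
Word n = List (Fin n)

Language : ℕ → Set₁
Language n = Pred (Word n) 0ℓ

private variable
  n : ℕ

-- Positions are numbered 0, …, length w - 1, so "position 1" of the usual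
-- convention is 0 here.

infix 8 _⟨_⟩

_⟨_⟩ : Word n → ℕ → Maybe (Fin n)
w ⟨ i ⟩ = head (drop i w)

-- |{ k : i < k < j, P (w(k)) }|
countBetween : {P : Pred (Fin n) 0ℓ} → Decidable P → Word n → ℕ → ℕ → ℕ
countBetween P? w i j =
  length (filter (λ k → i <? k ×-dec k <? j ×-dec Maybe.dec P? (w ⟨ k ⟩))
                 (upTo (length w)))

------------------------------------------------------------------------
-- Two-variable first-order logic

Var : Set
Var = Fin 2

data BetweenSignature : Set where
  inv th : BetweenSignature

data Between (n : ℕ) : BetweenSignature → Set where
  some    : Fin n → Between n inv
  atLeast : Fin n → ℕ → Between n th

BetweenHolds : {σ : BetweenSignature} → Between n σ → Word n → ℕ → ℕ → Set
BetweenHolds (some a)      w i j =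
  ∃[ k ] k < length w × i < k × k < j × w ⟨ k ⟩ ≡ just a
BetweenHolds (atLeast a k) w i j =
  i < j × k ≤ countBetween (Fin._≟ a) w i j

infixr 6 _∧_
infixr 5 _∨_

data FO² (n : ℕ) (σ : BetweenSignature) : Set where
  _≺_     : Var → Var → FO² n σ
  letter  : Fin n → Var → FO² n σ
  between : Between n σ → Var → Var → FO² n σ
  not     : FO² n σ → FO² n σ
  _∧_ _∨_ : FO² n σ → FO² n σ → FO² n σ
  ex all  : Var → FO² n σ → FO² n σ

Free : {σ : BetweenSignature} → FO² n σ → Pred Var 0ℓ
Free (u ≺ v)         x = x ≡ u ⊎ x ≡ v
Free (letter a v)    x = x ≡ v
Free (between b u v) x = x ≡ u ⊎ x ≡ v
Free (not φ)         x = Free φ x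
Free (φ ∧ ψ)         x = Free φ x ⊎ Free ψ x
Free (φ ∨ ψ)         x = Free φ x ⊎ Free ψ x
Free (ex v φ)        x = x ≢ v × Free φ x
Free (all v φ)       x = x ≢ v × Free φ x

Sentence : ℕ → BetweenSignature → Set
Sentence n σ = Σ[ φ ∈ FO² n σ ] Empty (Free φ)

-- Valuations take values in ℕ, so that they exist for the empty word too;
-- only the quantifiers are confined to the positions of w.

_,_⊨FO_ : {σ : BetweenSignature} → Word n → Vector ℕ 2 → FO² n σ → Set
w , ρ ⊨FO (u ≺ v)         = ρ u < ρ v
w , ρ ⊨FO (letter a v)    = w ⟨ ρ v ⟩ ≡ just a
w , ρ ⊨FO (between b u v) = BetweenHolds b w (ρ u) (ρ v)
w , ρ ⊨FO (not φ)         = ¬ (w , ρ ⊨FO φ)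
w , ρ ⊨FO (φ ∧ ψ)         = (w , ρ ⊨FO φ) × (w , ρ ⊨FO ψ)
w , ρ ⊨FO (φ ∨ ψ)         = (w , ρ ⊨FO φ) ⊎ (w , ρ ⊨FO ψ)
w , ρ ⊨FO (ex v φ)        =
  ∃[ i ] i < length w × (w , updateAt ρ v (const i) ⊨FO φ)
w , ρ ⊨FO (all v φ)       =
  ∀ i → i < length w → w , updateAt ρ v (const i) ⊨FO φ

-- The valuation is irrelevant, as a sentence has no free variables.
languageFO : {σ : BetweenSignature} → Sentence n σ → Language n
languageFO (φ , _) w = w , const 0 ⊨FO φ

------------------------------------------------------------------------
-- Temporal logic with constraints

data Comparison : Set where
  lt le gt ge eq : Comparison

Compare : Comparison → ℕ → ℕ → Set
Compare lt m c = m < c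
Compare le m c = m ≤ c
Compare gt m c = m > c
Compare ge m c = m ≥ c
Compare eq m c = m ≡ c

record Threshold (n : ℕ) : Set where
  constructor #
  field
    letters    : Subset n
    comparison : Comparison
    bound      : ℕ

data Invariant (n : ℕ) : Set where
  #_≡0 : Subset n → Invariant n

toThreshold : Invariant n → Threshold n
toThreshold (# B ≡0) = # B eq 0

data BooleanCombination (X : Set) : Set where
  atom    : X → BooleanCombination X
  not     : BooleanCombination X → BooleanCombination X
  _∧_ _∨_ : (g h : BooleanCombination X) → BooleanCombination X

⟦_⟧ᴮ : {X : Set} → BooleanCombination X → Pred X 0ℓ → Set
⟦ atom c ⟧ᴮ S = S c
⟦ not g  ⟧ᴮ S = ¬ ⟦ g ⟧ᴮ S
⟦ g ∧ h  ⟧ᴮ S = ⟦ g ⟧ᴮ S × ⟦ h ⟧ᴮ S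
⟦ g ∨ h  ⟧ᴮ S = ⟦ g ⟧ᴮ S ⊎ ⟦ h ⟧ᴮ S

data GuardKind : Set where
  Th BTh Inv BInv : GuardKind

Guard : ℕ → GuardKind → Set
Guard n Th   = Threshold n
Guard n BTh  = BooleanCombination (Threshold n)
Guard n Inv  = Invariant n
Guard n BInv = BooleanCombination (Invariant n)

ThresholdHolds : Word n → ℕ → ℕ → Pred (Threshold n) 0ℓ
ThresholdHolds w i j (# B ∼ c) = Compare ∼ (countBetween (_∈? B) w i j) c

InvariantHolds : Word n → ℕ → ℕ → Pred (Invariant n) 0ℓ
InvariantHolds w i j c = ThresholdHolds w i j (toThreshold c)

GuardHolds : (κ : GuardKind) → Word n → ℕ → ℕ → Pred (Guard n κ) 0ℓ
GuardHolds Th   w i j g = ThresholdHolds w i j g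
GuardHolds BTh  w i j g = ⟦ g ⟧ᴮ (ThresholdHolds w i j)
GuardHolds Inv  w i j g = InvariantHolds w i j g
GuardHolds BInv w i j g = ⟦ g ⟧ᴮ (InvariantHolds w i j)

-- ⊤ is the empty conjunction. It is redundant (a ∨ ¬ a) except over the empty
-- alphabet, where there would otherwise be no temporal formulas at all.
data TL (n : ℕ) (κ : GuardKind) : Set where
  ⊤       : TL n κ
  letter  : Fin n → TL n κ
  not     : TL n κ → TL n κ
  _∧_ _∨_ : TL n κ → TL n κ → TL n κ
  F P     : Guard n κ → TL n κ → TL n κ

_,_⊨TL_ : {κ : GuardKind} → Word n → ℕ → TL n κ → Set
w , i ⊨TL ⊤        = Unit
w , i ⊨TL letter a = w ⟨ i ⟩ ≡ just a
w , i ⊨TL not φ    = ¬ (w , i ⊨TL φ)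
w , i ⊨TL (φ ∧ ψ)  = (w , i ⊨TL φ) × (w , i ⊨TL ψ)
w , i ⊨TL (φ ∨ ψ)  = (w , i ⊨TL φ) ⊎ (w , i ⊨TL ψ)
_,_⊨TL_ {κ = κ} w i (F g φ) =
  ∃[ j ] j < length w × i < j × GuardHolds κ w i j g × (w , j ⊨TL φ)
_,_⊨TL_ {κ = κ} w i (P g φ) =
  ∃[ j ] j < length w × j < i × GuardHolds κ w j i g × (w , j ⊨TL φ)

-- The empty word has no first position. Evaluating at 0 there makes every
-- letter and every (existential) modality false and leaves the boolean
-- connectives unchanged, in line with the treatment of the empty word in
-- first-order logic. Were the empty word never a member, the temporal logics
-- could not define, for instance, the language of ∀x a(x).
languageTL : {κ : GuardKind} → TL n κ → Language n
languageTL φ w = w , 0 ⊨TL φ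

------------------------------------------------------------------------
-- The logics and the families of languages they define

data Logic : Set where
  TL[Th] TL[BTh] TL[Inv] TL[BInv] FO²[<,Th] FO²[<,Inv] : Logic

Formula : ℕ → Logic → Set
Formula n TL[Th]     = TL n Th
Formula n TL[BTh]    = TL n BTh
Formula n TL[Inv]    = TL n Inv
Formula n TL[BInv]   = TL n BInv
Formula n FO²[<,Th]  = Sentence n th
Formula n FO²[<,Inv] = Sentence n inv

language : (ℒ : Logic) → Formula n ℒ → Language n
language TL[Th]     = languageTL
language TL[BTh]    = languageTL
language TL[Inv]    = languageTL
language TL[BInv]   = languageTL
language FO²[<,Th]  = languageFO
language FO²[<,Inv] = languageFO

Definable : (n : ℕ) → Logic → Pred (Language n) 0ℓ
Definable n ℒ L = ∃[ φ ] L ≐ language {n} ℒ φ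

{-# OPTIONS --safe #-}
module Submission where

-- The translations form a cycle
--   TL[Inv] → FO²[<,Inv] → FO²[<,Th] → TL[BTh] → TL[Inv],
-- with TL[Th] and TL[BInv] lying between TL[Inv] and TL[BTh].
--
-- FO²[<,Th] → TL[BTh]: once the order of x and y is fixed, a formula in x and y
-- becomes a disjunction of clauses α(x) ∧ g(x,y) ∧ β(y) with g a guard; a
-- quantifier over x turns each clause into β ∧ P_g α or β ∧ F_g α.
--
-- TL[BTh] → TL[Inv]: reading a letter a turns a guard g into a residual guard,
-- in which the bounds of the thresholds counting a have dropped by one, and g
-- is insensitive to letters outside its support, the letters of those
-- thresholds that are not yet settled. So F_g φ jumps, under the invariant that
-- no letter of the support is passed, either to a position of φ (if g holds
-- with all counts 0) or to the next letter of the support, and continues from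
-- there with the residual of g. The residual by a letter of the support has
-- smaller total weight, so there are finitely many jumps.

open import Defs
open import Data.Bool using (Bool; true; false; if_then_else_)
open import Data.Fin using (Fin; zero; suc)
import Data.Fin.Properties as Fin
open import Data.Fin.Subset using (Subset; _∈_; _∪_; ⁅_⁆) renaming (⊥ to ∅; _⊆_ to _⊆ˢ_)
open import Data.Fin.Subset.Properties using (_∈?_; ∉⊥; p⊆p∪q; q⊆p∪q; x∈p∪q⁻; x∈⁅y⁆⇔x≡y)
open import Data.List using (List; []; _∷_; length; filter; upTo; map; foldr; allFin; _++_; cartesianProductWith)
open import Data.List.Membership.Propositional using (find; lose) renaming (_∈_ to _∈ˡ_)
open import Data.List.Membership.Propositional.Properties using (∈-upTo⁺; ∈-allFin; ∈-filter⁺)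
open import Data.List.Properties using (filter-accept; filter-reject; filter-none; filter-some)
open import Data.List.Relation.Unary.All as All using (All; []; _∷_)
import Data.List.Relation.Unary.All.Properties as All
open import Data.List.Relation.Unary.Any as Any using (Any; here; there)
import Data.List.Relation.Unary.Any.Properties as Any
open import Data.List.Relation.Unary.Unique.Propositional using (Unique; _∷_)
open import Data.List.Relation.Unary.Unique.Propositional.Properties using (upTo⁺)
open import Data.Maybe using (Maybe; just)
open import Data.Maybe.Properties using (≡-dec)
import Data.Maybe.Relation.Unary.Any as Maybe
open import Data.Nat using (ℕ; zero; suc; pred; _+_; _≤_; _<_; _<?_; _≟_; z≤n; s≤s; s≤s⁻¹; ∣_-_∣)
open import Data.Nat.Induction using (<-wellFounded)
open import Data.Nat.Properties
open import Data.Product using (∃-syntax; _×_; _,_; proj₁; proj₂; map₂)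
open import Data.Product.Function.NonDependent.Propositional using (_×-⇔_)
open import Data.Sum as Sum using (_⊎_; inj₁; inj₂; [_,_]′)
open import Data.Sum.Function.Propositional using (_⊎-⇔_)
open import Data.Unit using (tt)
open import Data.Vec.Functional using (Vector; updateAt)
open import Function using (_∘_; id; _⇔_; mk⇔; Equivalence; const)
open import Function.Construct.Composition using (_⇔-∘_)
open import Function.Construct.Identity using (⇔-id)
open import Function.Construct.Symmetry using (⇔-sym)
open import Function.Properties.Inverse using (↔⇒⇔)
open import Function.Related.Propositional using (≡⇒)
open import Function.Related.TypeIsomorphisms using (¬-cong-⇔)
open import Induction.WellFounded using (Acc; acc)
open import Level using (0ℓ)
open import Relation.Binary using (tri<; tri≈; tri>)
open import Relation.Binary.PropositionalEquality using (_≡_; _≢_; refl; sym; trans; cong; cong₂; subst; ≢-sym)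
open import Relation.Nullary using (¬_; Dec; yes; no; does; contradiction; _×-dec_; _⊎-dec_; ¬?; map′; decidable-stable)
open import Relation.Unary using (Pred; Decidable; Empty; _⊆_; _≐_)

open Equivalence using (to; from)

private variable
  n : ℕ
  κ κ′ : GuardKind

-- Counting letters

module _ {A : Set} {L Q : Pred A 0ℓ} (L? : Decidable L) (Q? : Decidable Q) where

  filter-agree : ∀ xs → All (λ x → L x ⇔ Q x) xs → filter L? xs ≡ filter Q? xs
  filter-agree []       []       = refl
  filter-agree (x ∷ xs) (e ∷ es) with Q? x
  ... | yes q = trans (filter-accept L? (from e q)) (cong (x ∷_) (filter-agree xs es))
  ... | no ¬q = trans (filter-reject L? (¬q ∘ to e)) (filter-agree xs es)

  -- Uniqueness makes `x` occur exactly once in the list; that occurrence is kept by the first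
  -- filter only, and the filters agree everywhere else.
  length-filter-insert : ∀ {x} → L x → ¬ Q x → (∀ {y} → y ≢ x → L y ⇔ Q y) →
                         ∀ {xs} → Unique xs → x ∈ˡ xs →
                         length (filter L? xs) ≡ suc (length (filter Q? xs))
  length-filter-insert p ¬q L⇔Q (x∉xs ∷ _) (here refl) =
    trans (cong length (filter-accept L? p))
          (cong (suc ∘ length) (trans (filter-agree _ (All.map (L⇔Q ∘ ≢-sym) x∉xs))
                                      (sym (filter-reject Q? ¬q))))
  length-filter-insert p ¬q L⇔Q {y ∷ _} (y∉ys ∷ u) (there x∈ys) with Q? y
  ... | yes qy = trans (cong length (filter-accept L? (from (L⇔Q (All.lookup y∉ys x∈ys)) qy)))
                       (cong suc (length-filter-insert p ¬q L⇔Q u x∈ys))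
  ... | no ¬qy = trans (cong length (filter-reject L? (¬qy ∘ to (L⇔Q (All.lookup y∉ys x∈ys)))))
                       (length-filter-insert p ¬q L⇔Q u x∈ys)

just⇒bounded : ∀ (w : Word n) {k a} → w ⟨ k ⟩ ≡ just a → k < length w
just⇒bounded (_ ∷ _) {zero}  _ = s≤s z≤n
just⇒bounded (_ ∷ w) {suc _} e = s≤s (just⇒bounded w e)

any⇒just : {A : Set} {L : Pred A 0ℓ} {m : Maybe A} → Maybe.Any L m → ∃[ a ] m ≡ just a × L a
any⇒just (Maybe.just p) = _ , refl , p

just⇒any : {A : Set} {L : Pred A 0ℓ} {m : Maybe A} {a : A} → m ≡ just a → L a → Maybe.Any L m
just⇒any refl = Maybe.just

-- Intervals read in either direction

data Direction : Set where
  future past : Direction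

-- Throughout, `i` is the current position and `j` the one sought. Sorting them by direction lets
-- one argument serve both `F` and `P`, whose guards always read the interval from left to right.
lower upper : Direction → ℕ → ℕ → ℕ
lower future i j = i
lower past   i j = j
upper future i j = j
upper past   i j = i

Before : Direction → ℕ → ℕ → Set
Before d i j = lower d i j < upper d i j

before? : ∀ d i j → Dec (Before d i j)
before? d i j = lower d i j <? upper d i j

Before-trans : ∀ d {i j k} → Before d i j → Before d j k → Before d i k
Before-trans future i<j j<k = <-trans i<j j<k
Before-trans past   j<i k<j = <-trans k<j j<i

Before-irrefl : ∀ d {i} → ¬ Before d i i
Before-irrefl future = <-irrefl refl
Before-irrefl past   = <-irrefl refl

Before-total : ∀ d {i j} → i ≢ j → ¬ Before d i j → Before d j i
Before-total future i≢j i≮j = ≤∧≢⇒< (≮⇒≥ i≮j) (≢-sym i≢j)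
Before-total past   i≢j j≮i = ≤∧≢⇒< (≮⇒≥ j≮i) i≢j

Before-closer : ∀ d {i j k} → Before d i j → Before d j k → ∣ i - j ∣ < ∣ i - k ∣
Before-closer future {i} {j} {k} i<j j<k
  rewrite m≤n⇒∣m-n∣≡n∸m (<⇒≤ i<j) | m≤n⇒∣m-n∣≡n∸m (<⇒≤ (<-trans i<j j<k)) =
  ∸-monoˡ-< j<k (<⇒≤ i<j)
Before-closer past {i} {j} {k} j<i k<j
  rewrite m≤n⇒∣n-m∣≡n∸m (<⇒≤ j<i) | m≤n⇒∣n-m∣≡n∸m (<⇒≤ (<-trans k<j j<i)) =
  ∸-monoʳ-< k<j (<⇒≤ j<i)

-- A position outside `w` carries no letter, so `Maybe.Any` already confines `k` to the word.
Inside : Direction → Pred (Fin n) 0ℓ → Word n → ℕ → ℕ → Pred ℕ 0ℓ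
Inside d L w i j k = Before d i k × Before d k j × Maybe.Any L (w ⟨ k ⟩)

Inside⇒bounded : ∀ d {L} (w : Word n) {i j k} → Inside d L w i j k → k < length w
Inside⇒bounded d w (_ , _ , p) = just⇒bounded w (proj₁ (proj₂ (any⇒just p)))

Vacant : Direction → Pred (Fin n) 0ℓ → Word n → ℕ → ℕ → Set
Vacant d L w i j = ∀ {k} → ¬ Inside d L w i j k

module _ (d : Direction) {L : Pred (Fin n) 0ℓ} (L? : Decidable L) (w : Word n) where

  countAlong : ℕ → ℕ → ℕ
  countAlong i j = countBetween L? w (lower d i j) (upper d i j)

  inside? : ∀ i j → Decidable (Inside d L w i j)
  inside? i j k = before? d i k ×-dec before? d k j ×-dec Maybe.dec L? (w ⟨ k ⟩)

countAlong-filter : ∀ d {L : Pred (Fin n) 0ℓ} (L? : Decidable L) w i j →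
  countAlong d L? w i j ≡ length (filter (inside? d L? w i j) (upTo (length w)))
countAlong-filter future L? w i j = refl
countAlong-filter past   L? w i j = cong length
  (filter-agree (inside? future L? w j i) (inside? past L? w i j) (upTo (length w))
    (All.universal (λ _ → mk⇔ (λ (l , r , p) → r , l , p) (λ (l , r , p) → r , l , p)) _))

module _ (d : Direction) {L : Pred (Fin n) 0ℓ} (L? : Decidable L) (w : Word n) {i j : ℕ} where

  Vacant⇔count≡0 : Vacant d L w i j ⇔ countAlong d L? w i j ≡ 0
  Vacant⇔count≡0 rewrite countAlong-filter d L? w i j = mk⇔
    (λ vacant → cong length (filter-none (inside? d L? w i j) (All.universal (λ _ h → vacant h) (upTo (length w)))))
    (λ none {k} h → contradiction (sym none)
      (<⇒≢ (filter-some (inside? d L? w i j) (Any.map (λ where refl → h) (∈-upTo⁺ (Inside⇒bounded d w h))))))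

  module _ {q : ℕ} {a : Fin n} (i⊏q : Before d i q) (q⊏j : Before d q j)
           (wq≡a : w ⟨ q ⟩ ≡ just a) (vacant : Vacant d L w i q) where

    private
      -- As nothing counted lies strictly between `i` and `q`, the counts from `i` and from `q` can
      -- differ only at `q` itself.
      later : ∀ {k} → k ≢ q → Inside d L w i j k ⇔ Inside d L w q j k
      later {k} k≢q = mk⇔
        (λ (i⊏k , k⊏j , p) → Before-total d k≢q (λ k⊏q → vacant (i⊏k , k⊏q , p)) , k⊏j , p)
        (λ (q⊏k , k⊏j , p) → Before-trans d i⊏q q⊏k , k⊏j , p)

    countAlong-hit : L a → countAlong d L? w i j ≡ suc (countAlong d L? w q j)
    countAlong-hit pa
      rewrite countAlong-filter d L? w i j | countAlong-filter d L? w q j =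
      length-filter-insert (inside? d L? w i j) (inside? d L? w q j)
        (i⊏q , q⊏j , just⇒any wq≡a pa) (Before-irrefl d ∘ proj₁) later
        (upTo⁺ (length w)) (∈-upTo⁺ (just⇒bounded w wq≡a))

    countAlong-miss : ¬ L a → countAlong d L? w i j ≡ countAlong d L? w q j
    countAlong-miss ¬pa
      rewrite countAlong-filter d L? w i j | countAlong-filter d L? w q j =
      cong length (filter-agree (inside? d L? w i j) (inside? d L? w q j)
        (upTo (length w)) (All.universal agree _))
      where
      notAt : ∀ {A : Set} → Maybe.Any L (w ⟨ q ⟩) → A
      notAt p with any⇒just p
      ... | b , wq≡b , pb with trans (sym wq≡a) wq≡b
      ... | refl = contradiction pb ¬pa
      agree : ∀ k → Inside d L w i j k ⇔ Inside d L w q j k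
      agree k with k ≟ q
      ... | yes refl = mk⇔ (λ (_ , _ , p) → notAt p) (λ (_ , _ , p) → notAt p)
      ... | no k≢q   = later k≢q

  -- Descent on the distance from `i`: as long as some such position lies strictly between `i` and
  -- `k`, move to it.
  nearest : ∀ {k} → Inside d L w i j k → ∃[ q ] Inside d L w i j q × Vacant d L w i q
  nearest h = go h (<-wellFounded _)
    where
    go : ∀ {k} → Inside d L w i j k → Acc _<_ ∣ i - k ∣ →
         ∃[ q ] Inside d L w i j q × Vacant d L w i q
    go {k} h@(i⊏k , k⊏j , _) (acc smaller) with anyUpTo? (inside? d L? w i k) (length w)
    ... | no none = k , h , λ h′ → none (_ , Inside⇒bounded d w h′ , h′)
    ... | yes (k′ , _ , i⊏k′ , k′⊏k , p) =
      go (i⊏k′ , Before-trans d k′⊏k k⊏j , p) (smaller (Before-closer d i⊏k′ k′⊏k))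

-- Temporal formulas

GuardAlong : Direction → (κ : GuardKind) → Word n → ℕ → ℕ → Pred (Guard n κ) 0ℓ
GuardAlong d κ w i j = GuardHolds κ w (lower d i j) (upper d i j)

Sees : Direction → Word n → ℕ → Pred ℕ 0ℓ → Set
Sees d w i R = ∃[ j ] j < length w × Before d i j × R j

position-cong : ∀ (w : Word n) {R S : Pred ℕ 0ℓ} → (∀ j → R j ⇔ S j) →
  (∃[ j ] j < length w × R j) ⇔ (∃[ j ] j < length w × S j)
position-cong w R⇔S = mk⇔ (λ (j , j< , r) → j , j< , to (R⇔S j) r)
                          (λ (j , j< , s) → j , j< , from (R⇔S j) s)

Sees-cong : ∀ d (w : Word n) {i} {R S : Pred ℕ 0ℓ} → (∀ j → R j ⇔ S j) → Sees d w i R ⇔ Sees d w i S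
Sees-cong d w R⇔S = position-cong w (λ j → ⇔-id _ ×-⇔ R⇔S j)

modality : Direction → Guard n κ → TL n κ → TL n κ
modality future = F
modality past   = P

modality-⇔ : ∀ d (g : Guard n κ) φ {w i} →
  (w , i ⊨TL modality d g φ) ⇔ Sees d w i (λ j → GuardAlong d κ w i j g × (w , j ⊨TL φ))
modality-⇔ future g φ = ⇔-id _
modality-⇔ past   g φ = ⇔-id _

constant : Bool → TL n κ
constant b = if b then ⊤ else not ⊤

constant-⇔ : ∀ {A : Set} (A? : Dec A) {w i} → (w , i ⊨TL constant {n} {κ} (does A?)) ⇔ A
constant-⇔ (yes a) = mk⇔ (const a) (const tt)
constant-⇔ (no ¬a) = mk⇔ (λ ¬⊤ → contradiction tt ¬⊤) (λ a → contradiction a ¬a)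

⋁ : List (TL n κ) → TL n κ
⋁ = foldr _∨_ (not ⊤)

⋁-⇔ : ∀ (φs : List (TL n κ)) {w i} → (w , i ⊨TL ⋁ φs) ⇔ Any (w , i ⊨TL_) φs
⋁-⇔ []       = mk⇔ (λ ¬⊤ → contradiction tt ¬⊤) λ ()
⋁-⇔ (φ ∷ φs) = mk⇔ [ here , there ∘ to (⋁-⇔ φs) ]′
  λ where (here h) → inj₁ h
          (there h) → inj₂ (from (⋁-⇔ φs) h)

-- Decidability of guards and temporal formulas

compare? : ∀ ∼ m c → Dec (Compare ∼ m c)
compare? lt m c = m <? c
compare? le m c = m ≤? c
compare? gt m c = c <? m
compare? ge m c = c ≤? m
compare? eq m c = m ≟ c

⟦⟧ᴮ? : {X : Set} {S : Pred X 0ℓ} → Decidable S → Decidable (λ g → ⟦ g ⟧ᴮ S)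
⟦⟧ᴮ? S? (atom c) = S? c
⟦⟧ᴮ? S? (not g)  = ¬? (⟦⟧ᴮ? S? g)
⟦⟧ᴮ? S? (g ∧ h)  = ⟦⟧ᴮ? S? g ×-dec ⟦⟧ᴮ? S? h
⟦⟧ᴮ? S? (g ∨ h)  = ⟦⟧ᴮ? S? g ⊎-dec ⟦⟧ᴮ? S? h

guard? : ∀ κ (w : Word n) i j → Decidable (GuardHolds κ w i j)
guard? Th   w i j g = compare? _ _ _
guard? BTh  w i j g = ⟦⟧ᴮ? (λ _ → compare? _ _ _) g
guard? Inv  w i j (# B ≡0) = _ ≟ 0
guard? BInv w i j g = ⟦⟧ᴮ? (λ where (# B ≡0) → _ ≟ 0) g

-- Supplies classical steps: it helps locate the failing conjunct of a refuted clause, and it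
-- provides the value that a formula takes in the empty word.
sat? : ∀ w i (φ : TL n κ) → Dec (w , i ⊨TL φ)
sat? w i ⊤          = yes tt
sat? w i (letter a) = ≡-dec Fin._≟_ _ _
sat? w i (not φ)    = ¬? (sat? w i φ)
sat? w i (φ ∧ ψ)    = sat? w i φ ×-dec sat? w i ψ
sat? w i (φ ∨ ψ)    = sat? w i φ ⊎-dec sat? w i ψ
sat? {κ = κ} w i (F g φ) =
  anyUpTo? (λ j → i <? j ×-dec guard? κ w i j g ×-dec sat? w j φ) (length w)
sat? {κ = κ} w i (P g φ) =
  anyUpTo? (λ j → j <? i ×-dec guard? κ w j i g ×-dec sat? w j φ) (length w)

-- Changing the modalities

-- Only the modalities depend on the kind of guard, so a translation is determined by a replacement
-- `◇` for them.
module Translation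
  (◇ : Direction → Guard n κ → TL n κ′ → TL n κ′)
  (◇-⇔ : ∀ d g φ {w i} →
    (w , i ⊨TL ◇ d g φ) ⇔ Sees d w i (λ j → GuardAlong d κ w i j g × (w , j ⊨TL φ)))
  where

  translate : TL n κ → TL n κ′
  translate ⊤          = ⊤
  translate (letter a) = letter a
  translate (not φ)    = not (translate φ)
  translate (φ ∧ ψ)    = translate φ ∧ translate ψ
  translate (φ ∨ ψ)    = translate φ ∨ translate ψ
  translate (F g φ)    = ◇ future g (translate φ)
  translate (P g φ)    = ◇ past g (translate φ)

  translate-⇔ : ∀ φ {w i} → (w , i ⊨TL φ) ⇔ (w , i ⊨TL translate φ)
  translate-⇔ ⊤          = ⇔-id _
  translate-⇔ (letter a) = ⇔-id _
  translate-⇔ (not φ)    = ¬-cong-⇔ (translate-⇔ φ)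
  translate-⇔ (φ ∧ ψ)    = translate-⇔ φ ×-⇔ translate-⇔ ψ
  translate-⇔ (φ ∨ ψ)    = translate-⇔ φ ⊎-⇔ translate-⇔ ψ
  translate-⇔ (F g φ) {w} = ⇔-sym (◇-⇔ future g (translate φ)) ⇔-∘
    Sees-cong future w (λ _ → ⇔-id _ ×-⇔ translate-⇔ φ)
  translate-⇔ (P g φ) {w} = ⇔-sym (◇-⇔ past g (translate φ)) ⇔-∘
    Sees-cong past w (λ _ → ⇔-id _ ×-⇔ translate-⇔ φ)

mapᴮ : {X Y : Set} → (X → Y) → BooleanCombination X → BooleanCombination Y
mapᴮ f (atom c) = atom (f c)
mapᴮ f (not g)  = not (mapᴮ f g)
mapᴮ f (g ∧ h)  = mapᴮ f g ∧ mapᴮ f h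
mapᴮ f (g ∨ h)  = mapᴮ f g ∨ mapᴮ f h

⟦mapᴮ⟧ : ∀ {X Y : Set} (f : X → Y) g {S : Pred Y 0ℓ} → ⟦ mapᴮ f g ⟧ᴮ S ⇔ ⟦ g ⟧ᴮ (S ∘ f)
⟦mapᴮ⟧ f (atom c) = ⇔-id _
⟦mapᴮ⟧ f (not g)  = ¬-cong-⇔ (⟦mapᴮ⟧ f g)
⟦mapᴮ⟧ f (g ∧ h)  = ⟦mapᴮ⟧ f g ×-⇔ ⟦mapᴮ⟧ f h
⟦mapᴮ⟧ f (g ∨ h)  = ⟦mapᴮ⟧ f g ⊎-⇔ ⟦mapᴮ⟧ f h

module GuardMap
  (f : Guard n κ → Guard n κ′)
  (f-⇔ : ∀ g {w i j} → GuardHolds κ′ w i j (f g) ⇔ GuardHolds κ w i j g) where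

  open Translation {n} {κ} {κ′} (λ d g → modality d (f g))
    (λ d g φ {w} → Sees-cong d w (λ _ → f-⇔ g ×-⇔ ⇔-id _) ⇔-∘ modality-⇔ d (f g) φ) public

-- Residual guards

-- The number of counted letters after which the truth value is settled: `lt c` fails and `ge c`
-- holds from count `c` on, whereas the other three settle only at `suc c`.
weightᶜ : Comparison → ℕ → ℕ
weightᶜ lt c = c
weightᶜ le c = suc c
weightᶜ gt c = suc c
weightᶜ ge c = c
weightᶜ eq c = suc c

-- At bound 0, a comparison settled by one more letter turns into `lt 0`, false at every count, or
-- `ge 0`, true at every count. These two are fixed by `advance` and are the only ones of weight 0.
advance : Comparison → ℕ → Comparison × ℕ
advance lt zero    = lt , 0
advance lt (suc c) = lt , c
advance le zero    = lt , 0
advance le (suc c) = le , c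
advance gt zero    = ge , 0
advance gt (suc c) = gt , c
advance ge zero    = ge , 0
advance ge (suc c) = ge , c
advance eq zero    = lt , 0
advance eq (suc c) = eq , c

private
  s≤s-⇔ : ∀ {m c} → suc m ≤ suc c ⇔ m ≤ c
  s≤s-⇔ = mk⇔ s≤s⁻¹ s≤s

advance-⇔ : ∀ ∼ c {m} → let ∼′ , c′ = advance ∼ c in Compare ∼ (suc m) c ⇔ Compare ∼′ m c′
advance-⇔ lt zero    = mk⇔ (λ ()) (λ ())
advance-⇔ lt (suc c) = s≤s-⇔
advance-⇔ le zero    = mk⇔ (λ ()) (λ ())
advance-⇔ le (suc c) = s≤s-⇔
advance-⇔ gt zero    = mk⇔ (const z≤n) (const (s≤s z≤n))
advance-⇔ gt (suc c) = s≤s-⇔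
advance-⇔ ge zero    = mk⇔ (const z≤n) (const z≤n)
advance-⇔ ge (suc c) = s≤s-⇔
advance-⇔ eq zero    = mk⇔ (λ ()) (λ ())
advance-⇔ eq (suc c) = mk⇔ suc-injective (cong suc)

weightᶜ-advance : ∀ ∼ c → let ∼′ , c′ = advance ∼ c in weightᶜ ∼′ c′ ≡ pred (weightᶜ ∼ c)
weightᶜ-advance lt zero    = refl
weightᶜ-advance lt (suc c) = refl
weightᶜ-advance le zero    = refl
weightᶜ-advance le (suc c) = refl
weightᶜ-advance gt zero    = refl
weightᶜ-advance gt (suc c) = refl
weightᶜ-advance ge zero    = refl
weightᶜ-advance ge (suc c) = refl
weightᶜ-advance eq zero    = refl
weightᶜ-advance eq (suc c) = refl

weightless : ∀ ∼ c → weightᶜ ∼ c ≡ 0 → ∀ {m m′} → Compare ∼ m c ⇔ Compare ∼ m′ c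
weightless lt zero _ = mk⇔ (λ ()) (λ ())
weightless ge zero _ = mk⇔ (const z≤n) (const z≤n)

weightless-advance : ∀ ∼ c → weightᶜ ∼ c ≡ 0 → advance ∼ c ≡ (∼ , c)
weightless-advance lt zero _ = refl
weightless-advance ge zero _ = refl

residualᵗ : Fin n → Threshold n → Threshold n
residualᵗ a (# B ∼ c) with a ∈? B
... | yes _ = let ∼′ , c′ = advance ∼ c in # B ∼′ c′
... | no  _ = # B ∼ c

-- A threshold of weight 0 has the same truth value at every count, so its
-- letters may be read without any effect on it.
supportᵗ : Threshold n → Subset n
supportᵗ (# B ∼ c) with weightᶜ ∼ c
... | zero  = ∅
... | suc _ = B

BGuard : ℕ → Set
BGuard n = Guard n BTh

residual : Fin n → BGuard n → BGuard n
residual a = mapᴮ (residualᵗ a)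

weight : BGuard n → ℕ
weight (atom (# _ ∼ c)) = weightᶜ ∼ c
weight (not g)          = weight g
weight (g ∧ h)          = weight g + weight h
weight (g ∨ h)          = weight g + weight h

support : BGuard n → Subset n
support (atom t) = supportᵗ t
support (not g)  = support g
support (g ∧ h)  = support g ∪ support h
support (g ∨ h)  = support g ∪ support h

weight-residual-≤ : ∀ (a : Fin n) g → weight (residual a g) ≤ weight g
weight-residual-≤ a (atom (# B ∼ c)) with a ∈? B
... | yes _ rewrite weightᶜ-advance ∼ c = pred[n]≤n
... | no _ = ≤-refl
weight-residual-≤ a (not g) = weight-residual-≤ a g
weight-residual-≤ a (g ∧ h) = +-mono-≤ (weight-residual-≤ a g) (weight-residual-≤ a h)
weight-residual-≤ a (g ∨ h) = +-mono-≤ (weight-residual-≤ a g) (weight-residual-≤ a h)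

-- A letter of the support belongs to some threshold of positive weight, which loses one; no other
-- threshold gains. Hence `weight g` bounds the number of jumps.
weight-residual-< : ∀ {a : Fin n} g → a ∈ support g → weight (residual a g) < weight g
weight-residual-<-both : ∀ {a : Fin n} g h → a ∈ support g ∪ support h →
  weight (residual a g) + weight (residual a h) < weight g + weight h

weight-residual-< {a = a} (atom (# B ∼ c)) a∈ with a ∈? B | weightᶜ ∼ c in weight≡
... | _      | zero  = contradiction a∈ ∉⊥
... | yes _  | suc m rewrite weightᶜ-advance ∼ c | weight≡ = ≤-refl
... | no a∉B | suc m = contradiction a∈ a∉B
weight-residual-< (not g) = weight-residual-< g
weight-residual-< (g ∧ h) = weight-residual-<-both g h
weight-residual-< (g ∨ h) = weight-residual-<-both g h

weight-residual-<-both g h a∈ with x∈p∪q⁻ (support g) (support h) a∈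
... | inj₁ a∈g = +-mono-<-≤ (weight-residual-< g a∈g) (weight-residual-≤ _ h)
... | inj₂ a∈h = +-mono-≤-< (weight-residual-≤ _ g) (weight-residual-< h a∈h)

-- The inclusion of supports gives each threshold of `g` the vacancy known for the support of the
-- whole guard.
⟦⟧ᴮ-cong : ∀ (g : BGuard n) {S S′ : Pred (Threshold n) 0ℓ} →
  (∀ t → supportᵗ t ⊆ˢ support g → S t ⇔ S′ t) → ⟦ g ⟧ᴮ S ⇔ ⟦ g ⟧ᴮ S′
⟦⟧ᴮ-cong (atom t) S⇔ = S⇔ t id
⟦⟧ᴮ-cong (not g)  S⇔ = ¬-cong-⇔ (⟦⟧ᴮ-cong g S⇔)
⟦⟧ᴮ-cong (g ∧ h)  S⇔ = ⟦⟧ᴮ-cong g (λ t t⊆ → S⇔ t (p⊆p∪q _ ∘ t⊆))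
                   ×-⇔ ⟦⟧ᴮ-cong h (λ t t⊆ → S⇔ t (q⊆p∪q _ _ ∘ t⊆))
⟦⟧ᴮ-cong (g ∨ h)  S⇔ = ⟦⟧ᴮ-cong g (λ t t⊆ → S⇔ t (p⊆p∪q _ ∘ t⊆))
                   ⊎-⇔ ⟦⟧ᴮ-cong h (λ t t⊆ → S⇔ t (q⊆p∪q _ _ ∘ t⊆))

Vacant-⊆ : ∀ d {B C : Subset n} {w i j} → B ⊆ˢ C → Vacant d (_∈ C) w i j → Vacant d (_∈ B) w i j
Vacant-⊆ d B⊆C vacant (l , r , p) = vacant (l , r , Maybe.map B⊆C p)

InitiallyHolds : Pred (BGuard n) 0ℓ
InitiallyHolds g = ⟦ g ⟧ᴮ (λ (# _ ∼ c) → Compare ∼ 0 c)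

initially? : Decidable (InitiallyHolds {n})
initially? = ⟦⟧ᴮ? (λ _ → compare? _ _ _)

module _ (d : Direction) (w : Word n) {i j : ℕ} where

  -- A settled threshold has the same value at every count; an unsettled one has all its letters in
  -- the support, so its count is 0.
  guard-vacant : ∀ g → Vacant d (_∈ support g) w i j →
                 GuardAlong d BTh w i j g ⇔ InitiallyHolds g
  guard-vacant g vacant = ⟦⟧ᴮ-cong g (λ t t⊆ → threshold t (Vacant-⊆ d t⊆ vacant))
    where
    threshold : ∀ ((# B ∼ c) : Threshold n) → Vacant d (_∈ supportᵗ (# B ∼ c)) w i j →
                Compare ∼ (countAlong d (_∈? B) w i j) c ⇔ Compare ∼ 0 c
    threshold (# B ∼ c) vacantᵗ with weightᶜ ∼ c in weight≡
    ... | zero  = weightless ∼ c weight≡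
    ... | suc _ rewrite to (Vacant⇔count≡0 d (_∈? B) w) vacantᵗ = ⇔-id _

  -- An unsettled threshold has counted nothing before `q`, so its counts from `i` and from `q`
  -- differ at most by the letter `a`, which `residual` absorbs.
  guard-residual : ∀ g {q a} → Before d i q → Before d q j → w ⟨ q ⟩ ≡ just a →
                   Vacant d (_∈ support g) w i q →
                   GuardAlong d BTh w i j g ⇔ GuardAlong d BTh w q j (residual a g)
  guard-residual g {q} {a} i⊏q q⊏j wq≡a vacant =
    ⇔-sym (⟦mapᴮ⟧ (residualᵗ a) g) ⇔-∘
    ⟦⟧ᴮ-cong g (λ t t⊆ → threshold t (Vacant-⊆ d t⊆ vacant))
    where
    threshold : ∀ (t : Threshold n) → Vacant d (_∈ supportᵗ t) w i q →
                ThresholdHolds w (lower d i j) (upper d i j) t ⇔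
                ThresholdHolds w (lower d q j) (upper d q j) (residualᵗ a t)
    threshold (# B ∼ c) vacantᵗ with weightᶜ ∼ c in weight≡ | a ∈? B
    -- The invariant does not block the letters of a settled threshold, so its count may have grown
    -- by any amount before `q`; its value is constant and `advance` leaves it alone.
    ... | zero  | yes _ rewrite weightless-advance ∼ c weight≡ = weightless ∼ c weight≡
    ... | zero  | no _ = weightless ∼ c weight≡
    ... | suc _ | yes a∈B
      rewrite countAlong-hit d (_∈? B) w i⊏q q⊏j wq≡a vacantᵗ a∈B = advance-⇔ ∼ c
    ... | suc _ | no a∉B
      rewrite countAlong-miss d (_∈? B) w i⊏q q⊏j wq≡a vacantᵗ a∉B = ⇔-id _

-- From boolean threshold guards to invariant guards

module Reach (d : Direction) (φ : TL n Inv) where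

  skip : BGuard n → TL n Inv → TL n Inv
  skip g = modality d (# support g ≡0)

  arrive : BGuard n → TL n Inv
  arrive g = constant (does (initially? g)) ∧ skip g φ

  viaLetter : (BGuard n → TL n Inv) → BGuard n → Fin n → TL n Inv
  viaLetter continue g a = skip g (letter a ∧ continue (residual a g))

  -- Fuel bounds the number of intermediate stops. Without fuel only the final jump remains, which
  -- suffices at weight 0, where the support is empty.
  reach : ℕ → BGuard n → TL n Inv
  reach zero       g = arrive g
  reach (suc fuel) g = arrive g ∨ ⋁ (map (viaLetter (reach fuel) g) (allFin n))

  module _ {w : Word n} where

    Reaches : BGuard n → ℕ → Set
    Reaches g i = Sees d w i (λ j → GuardAlong d BTh w i j g × (w , j ⊨TL φ))

    skip-⇔ : ∀ g ψ {i} → (w , i ⊨TL skip g ψ) ⇔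
      Sees d w i (λ j → Vacant d (_∈ support g) w i j × (w , j ⊨TL ψ))
    skip-⇔ g ψ = Sees-cong d w (λ _ → ⇔-sym (Vacant⇔count≡0 d (_∈? support g) w) ×-⇔ ⇔-id _)
      ⇔-∘ modality-⇔ d (# support g ≡0) ψ

    arrive-sound : ∀ g {i} → w , i ⊨TL arrive g → Reaches g i
    arrive-sound g (c , s) =
      let j , j< , i⊏j , vacant , h = to (skip-⇔ g φ) s
      in j , j< , i⊏j , from (guard-vacant d w g vacant) (to (constant-⇔ (initially? g)) c) , h

    -- Any amount of fuel will do: read backwards, `guard-residual` carries the residual guard at
    -- each stop to the guard before the jump.
    reach-sound : ∀ fuel g {i} → w , i ⊨TL reach fuel g → Reaches g i
    reach-sound zero       g h = arrive-sound g h
    reach-sound (suc fuel) g (inj₁ h) = arrive-sound g h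
    reach-sound (suc fuel) g (inj₂ h) =
      let a , h′ = Any.satisfied (Any.map⁻ (to (⋁-⇔ (map (viaLetter (reach fuel) g) (allFin n))) h))
          q , q< , i⊏q , vacant , wq≡a , r =
            to (skip-⇔ g (letter a ∧ reach fuel (residual a g))) h′
          j , j< , q⊏j , gj , s = reach-sound fuel (residual a g) r
      in j , j< , Before-trans d i⊏q q⊏j , from (guard-residual d w g i⊏q q⊏j wq≡a vacant) gj , s

    arrive⇒reach : ∀ fuel g {i} → w , i ⊨TL arrive g → w , i ⊨TL reach fuel g
    arrive⇒reach zero    g = id
    arrive⇒reach (suc _) g = inj₁

    -- Either no support letter lies strictly between `i` and `j`, and the final jump goes to `j`,
    -- or the support letter nearest to `i` is the next stop.
    reach-complete : ∀ fuel g {i} → weight g ≤ fuel → Reaches g i → w , i ⊨TL reach fuel g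
    reach-complete fuel g {i} g≤ (j , j< , i⊏j , gj , s)
      with anyUpTo? (inside? d (_∈? support g) w i j) (length w)
    ... | no none = arrive⇒reach fuel g
      ( from (constant-⇔ (initially? g)) (to (guard-vacant d w g vacant) gj)
      , from (skip-⇔ g φ) (j , j< , i⊏j , vacant , s))
      where
      vacant : Vacant d (_∈ support g) w i j
      vacant h = none (_ , Inside⇒bounded d w h , h)
    ... | yes (_ , _ , h) with nearest d (_∈? support g) w h
    ... | q , (i⊏q , q⊏j , p) , vacant with any⇒just p
    ... | a , wq≡a , a∈ with fuel | <-≤-trans (weight-residual-< g a∈) g≤
    -- The weight drops strictly at this stop and was bounded by the fuel, so some fuel was left.
    ... | zero       | ()
    ... | suc fuel′ | less = inj₂ (from (⋁-⇔ _) (Any.map⁺ (Any.map (λ where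
          refl → from (skip-⇔ g _)
            ( q , just⇒bounded w wq≡a , i⊏q , vacant , wq≡a
            , reach-complete fuel′ (residual a g) (s≤s⁻¹ less)
                (j , j< , q⊏j , to (guard-residual d w g i⊏q q⊏j wq≡a vacant) gj , s)))
          (∈-allFin a))))

  invariantModality : BGuard n → TL n Inv
  invariantModality g = reach (weight g) g

  invariantModality-⇔ : ∀ g {w i} → (w , i ⊨TL invariantModality g) ⇔
    Sees d w i (λ j → GuardAlong d BTh w i j g × (w , j ⊨TL φ))
  invariantModality-⇔ g = mk⇔ (reach-sound (weight g) g) (reach-complete (weight g) g ≤-refl)

-- From two-variable first-order logic to temporal logic

other : Var → Var
other zero       = suc zero
other (suc zero) = zero

other-involutive : ∀ v → other (other v) ≡ v
other-involutive zero       = refl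
other-involutive (suc zero) = refl

same-or-other : ∀ u v → u ≡ v ⊎ u ≡ other v
same-or-other zero       zero       = inj₁ refl
same-or-other zero       (suc zero) = inj₂ refl
same-or-other (suc zero) zero       = inj₂ refl
same-or-other (suc zero) (suc zero) = inj₁ refl

module _ (ρ : Vector ℕ 2) (i : ℕ) where

  update-same : ∀ v → updateAt ρ v (const i) v ≡ i
  update-same zero       = refl
  update-same (suc zero) = refl

  update-other : ∀ v → updateAt ρ v (const i) (other v) ≡ ρ (other v)
  update-other zero       = refl
  update-other (suc zero) = refl

  update-other′ : ∀ v → updateAt ρ (other v) (const i) v ≡ ρ v
  update-other′ zero       = refl
  update-other′ (suc zero) = refl

  update-all : ∀ v → i ≡ ρ (other v) → ∀ u → updateAt ρ v (const i) u ≡ ρ (other v)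
  update-all v i≡ u with same-or-other u v
  ... | inj₁ refl = trans (update-same v) i≡
  ... | inj₂ refl = update-other v

between-th? : ∀ (b : Between n th) w i j → Dec (BetweenHolds b w i j)
between-th? (atLeast a k) w i j = i <? j ×-dec k ≤? countBetween (Fin._≟ a) w i j

-- Serves to read a universal quantifier as a negated existential one, where double negation has to
-- be removed.
satFO? : ∀ (w : Word n) ρ (φ : FO² n th) → Dec (w , ρ ⊨FO φ)
satFO? w ρ (u ≺ v)         = ρ u <? ρ v
satFO? w ρ (letter a v)    = ≡-dec Fin._≟_ (w ⟨ ρ v ⟩) (just a)
satFO? w ρ (between b u v) = between-th? b w (ρ u) (ρ v)
satFO? w ρ (not φ)         = ¬? (satFO? w ρ φ)
satFO? w ρ (φ ∧ ψ)         = satFO? w ρ φ ×-dec satFO? w ρ ψ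
satFO? w ρ (φ ∨ ψ)         = satFO? w ρ φ ⊎-dec satFO? w ρ ψ
satFO? w ρ (ex v φ)        = anyUpTo? (λ i → satFO? w (updateAt ρ v (const i)) φ) (length w)
satFO? w ρ (all v φ)       = map′ (λ h i → h {i}) (λ h {i} → h i)
  (allUpTo? (λ i → satFO? w (updateAt ρ v (const i)) φ) (length w))

-- Disjunctions of clauses

record Clause (n : ℕ) : Set where
  constructor clause
  field
    low   : TL n BTh
    guard : BGuard n
    high  : TL n BTh
open Clause

ClauseHolds : Word n → ℕ → ℕ → Pred (Clause n) 0ℓ
ClauseHolds w i j (clause α g β) = (w , i ⊨TL α) × GuardHolds BTh w i j g × (w , j ⊨TL β)

clauseHolds? : ∀ w i j → Decidable (ClauseHolds {n} w i j)
clauseHolds? w i j (clause α g β) = sat? w i α ×-dec guard? BTh w i j g ×-dec sat? w j β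

always : BGuard n
always = atom (# ∅ ge 0)

Disjunction : ℕ → Set
Disjunction n = List (Clause n)

DisjunctionHolds : Word n → ℕ → ℕ → Pred (Disjunction n) 0ℓ
DisjunctionHolds w i j = Any (ClauseHolds w i j)

conjunction : Disjunction n → Disjunction n → Disjunction n
conjunction = cartesianProductWith
  λ (clause α g β) (clause α′ g′ β′) → clause (α ∧ α′) (g ∧ g′) (β ∧ β′)

-- De Morgan, with one clause per negated conjunct. Boolean guards make this possible: they are
-- closed under negation here and under meets in `conjunction`.
negateClause : Clause n → Disjunction n
negateClause (clause α g β) =
  clause (not α) always ⊤ ∷ clause ⊤ (not g) ⊤ ∷ clause ⊤ always (not β) ∷ []

negation : Disjunction n → Disjunction n
negation []       = clause ⊤ always ⊤ ∷ []
negation (c ∷ cs) = conjunction (negateClause c) (negation cs)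

module _ (w : Word n) {i j : ℕ} where

  conjunction-⇔ : ∀ D E → DisjunctionHolds w i j (conjunction D E) ⇔
                          (DisjunctionHolds w i j D × DisjunctionHolds w i j E)
  conjunction-⇔ D E = mk⇔
    (Any.cartesianProductWith⁻ _ (λ ((l , l′) , (g , g′) , (h , h′)) → (l , g , h) , (l′ , g′ , h′)) D E)
    (λ (d , e) → Any.cartesianProductWith⁺ _
      (λ (l , g , h) (l′ , g′ , h′) → (l , l′) , (g , g′) , (h , h′)) d e)

  negateClause-⇔ : ∀ c → DisjunctionHolds w i j (negateClause c) ⇔ (¬ ClauseHolds w i j c)
  negateClause-⇔ c@(clause α g β) = mk⇔
    (λ where (here (¬l , _))                 (l , _)     → ¬l l
             (there (here (_ , ¬g , _)))     (_ , g , _) → ¬g g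
             (there (there (here (_ , _ , ¬h)))) (_ , _ , h) → ¬h h)
    refute
    where
    refute : ¬ ClauseHolds w i j c → DisjunctionHolds w i j (negateClause c)
    refute ¬c with sat? w i α | guard? BTh w i j g
    ... | no ¬l | _     = here (¬l , z≤n , tt)
    ... | yes _ | no ¬g = there (here (tt , ¬g , tt))
    ... | yes l | yes g = there (there (here (tt , z≤n , λ h → ¬c (l , g , h))))

  negation-⇔ : ∀ D → DisjunctionHolds w i j (negation D) ⇔ (¬ DisjunctionHolds w i j D)
  negation-⇔ []       = mk⇔ (λ _ ()) (λ _ → here (tt , z≤n , tt))
  negation-⇔ (c ∷ cs) =
    mk⇔ (λ (¬c , ¬cs) → λ where (here h) → ¬c h
                                (there h) → ¬cs h)
        (λ ¬any → ¬any ∘ here , ¬any ∘ there)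
    ⇔-∘ ((negateClause-⇔ c ×-⇔ negation-⇔ cs) ⇔-∘ conjunction-⇔ (negateClause c) (negation cs))

-- `near` is evaluated at the current position and `far` at the one sought; looking into the past,
-- the current position is the larger one.
near far : Direction → Clause n → TL n BTh
near future = low
near past   = high
far future  = high
far past    = low

lookClause : Direction → Clause n → TL n BTh
lookClause d c = near d c ∧ modality d (guard c) (far d c)

look : Direction → Disjunction n → TL n BTh
look d D = ⋁ (map (lookClause d) D)

clauseAlong : ∀ d (w : Word n) c {i j} → ClauseHolds w (lower d i j) (upper d i j) c ⇔
  ((w , i ⊨TL near d c) × GuardAlong d BTh w i j (guard c) × (w , j ⊨TL far d c))
clauseAlong future w c = ⇔-id _
clauseAlong past   w c = mk⇔ (λ (l , g , h) → h , g , l) (λ (h , g , l) → l , g , h)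

look-⇔ : ∀ d (w : Word n) D {i} →
  (w , i ⊨TL look d D) ⇔ Sees d w i (λ j → DisjunctionHolds w (lower d i j) (upper d i j) D)
look-⇔ d w D {i} = mk⇔ there⇒ ⇒there ⇔-∘ ⋁-⇔ (map (lookClause d) D)
  where
  there⇒ : Any (w , i ⊨TL_) (map (lookClause d) D) →
           Sees d w i (λ j → DisjunctionHolds w (lower d i j) (upper d i j) D)
  there⇒ h =
    let c , c∈D , near-c , m = find (Any.map⁻ h)
        j , j< , i⊏j , g , far-c = to (modality-⇔ d (guard c) (far d c)) m
    in j , j< , i⊏j , lose c∈D (from (clauseAlong d w c) (near-c , g , far-c))
  ⇒there : Sees d w i (λ j → DisjunctionHolds w (lower d i j) (upper d i j) D) →
           Any (w , i ⊨TL_) (map (lookClause d) D)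
  ⇒there (j , j< , i⊏j , h) = Any.map⁺ (Any.map (λ {c} hc →
    let near-c , g , far-c = to (clauseAlong d w c) hc
    in near-c , from (modality-⇔ d (guard c) (far d c)) (j , j< , i⊏j , g , far-c)) h)

-- A formula in two variables, rewritten once for each order type of its
-- variables: on the diagonal as a temporal formula, and off it as a disjunction
-- of clauses; in ordered v, the variable v takes the smaller value.
record Separated (n : ℕ) : Set where
  constructor separated
  field
    diagonal : TL n BTh
    ordered  : Var → Disjunction n
open Separated

-- The values of the variables are arbitrary numbers, so position 0 of the empty word is covered as
-- well.
record Represents (w : Word n) (T : Separated n) (R : Pred (Vector ℕ 2) 0ℓ) : Set where
  field
    diagonal-⇔ : ∀ {ρ i} → (∀ v → ρ v ≡ i) → R ρ ⇔ (w , i ⊨TL diagonal T)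
    ordered-⇔  : ∀ {ρ i j} v → ρ v ≡ i → ρ (other v) ≡ j → i < j →
                 R ρ ⇔ DisjunctionHolds w i j (ordered T v)
open Represents

-- Says that the current position lies in the word. A quantifier ranges over positions of the word
-- only, whereas a diagonal formula can hold outside, as at 0 in the empty word.
occupied : TL n κ
occupied {n} = ⋁ (map letter (allFin n))

bounded⇒just : ∀ (w : Word n) {k} → k < length w → ∃[ a ] w ⟨ k ⟩ ≡ just a
bounded⇒just (a ∷ _) {zero}  _  = a , refl
bounded⇒just (_ ∷ w) {suc _} k< = bounded⇒just w (s≤s⁻¹ k<)

occupied-⇔ : ∀ (w : Word n) {i} → (w , i ⊨TL occupied {κ = κ}) ⇔ i < length w
occupied-⇔ w = mk⇔
  (λ h → just⇒bounded w (proj₂ (Any.satisfied (Any.map⁻ h))))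
  (λ i< → let a , wi≡a = bounded⇒just w i<
          in Any.map⁺ (Any.map (λ where refl → wi≡a) (∈-allFin a)))
  ⇔-∘ ⋁-⇔ (map letter (allFin _))

unaryˢ : Var → TL n BTh → Separated n
unaryˢ {n} x α = separated α side
  where
  side : Var → Disjunction n
  side v with same-or-other x v
  ... | inj₁ _ = clause α always ⊤ ∷ []
  ... | inj₂ _ = clause ⊤ always α ∷ []

-- Meant for atoms that force `x` below `y`: they fail on the diagonal and in the order type with
-- `y` below `x`.
binaryˢ : Var → Var → BGuard n → Separated n
binaryˢ {n} x y g = separated (not ⊤) side
  where
  side : Var → Disjunction n
  side v with same-or-other x v | same-or-other y v
  ... | inj₁ _ | inj₂ _ = clause ⊤ g ⊤ ∷ []
  ... | _      | _      = []

notˢ : Separated n → Separated n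
notˢ (separated δ o) = separated (not δ) (negation ∘ o)

_∧ˢ_ _∨ˢ_ : Separated n → Separated n → Separated n
separated δ o ∧ˢ separated δ′ o′ = separated (δ ∧ δ′) (λ v → conjunction (o v) (o′ v))
separated δ o ∨ˢ separated δ′ o′ = separated (δ ∨ δ′) (λ v → o v ++ o′ v)

-- Evaluated at the value of the other variable; the disjuncts place `v` below it, on it and above
-- it.
somewhere : Var → Separated n → TL n BTh
somewhere v (separated δ o) = look past (o v) ∨ (occupied ∧ δ) ∨ look future (o (other v))

-- Once `v` is quantified, truth depends on the value of the other variable alone.
exˢ : Var → Separated n → Separated n
exˢ v T = unaryˢ (other v) (somewhere v T)

separate : FO² n th → Separated n
separate (u ≺ v)                     = binaryˢ u v always
separate (letter a v)                = unaryˢ v (letter a)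
separate (between (atLeast a k) u v) = binaryˢ u v (atom (# ⁅ a ⁆ ge k))
separate (not φ)                     = notˢ (separate φ)
separate (φ ∧ ψ)                     = separate φ ∧ˢ separate ψ
separate (φ ∨ ψ)                     = separate φ ∨ˢ separate ψ
separate (ex v φ)                    = exˢ v (separate φ)
separate (all v φ)                   = notˢ (exˢ v (notˢ (separate φ)))

-- Correctness of the separation

module _ {w : Word n} where

  Represents-resp : ∀ {T} {R S : Pred (Vector ℕ 2) 0ℓ} → (∀ ρ → S ρ ⇔ R ρ) →
                    Represents w T R → Represents w T S
  Represents-resp S⇔R r .diagonal-⇔ e       = diagonal-⇔ r e ⇔-∘ S⇔R _
  Represents-resp S⇔R r .ordered-⇔ v e e′ l = ordered-⇔ r v e e′ l ⇔-∘ S⇔R _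

  unaryˢ-represents : ∀ x α → Represents w (unaryˢ x α) (λ ρ → w , ρ x ⊨TL α)
  unaryˢ-represents x α .diagonal-⇔ e rewrite e x = ⇔-id _
  unaryˢ-represents x α .ordered-⇔ v refl refl _ with same-or-other x v
  ... | inj₁ refl = mk⇔ (λ h → here (h , z≤n , tt)) (λ where (here (h , _)) → h)
  ... | inj₂ refl = mk⇔ (λ h → here (tt , z≤n , h)) (λ where (here (_ , _ , h)) → h)

  binaryˢ-represents : ∀ x y g → Represents w (binaryˢ x y g)
    (λ ρ → ρ x < ρ y × GuardHolds BTh w (ρ x) (ρ y) g)
  binaryˢ-represents x y g .diagonal-⇔ e rewrite e x | e y = mk⇔
    (λ (i<i , _) → contradiction i<i (<-irrefl refl)) (λ ¬⊤ → contradiction tt ¬⊤)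
  binaryˢ-represents x y g .ordered-⇔ v refl refl l with same-or-other x v | same-or-other y v
  ... | inj₁ refl | inj₁ refl = mk⇔ (λ (l′ , _) → contradiction l′ (<-irrefl refl)) (λ ())
  ... | inj₁ refl | inj₂ refl = mk⇔ (λ (_ , h) → here (tt , h , tt)) (λ where (here (_ , h , _)) → l , h)
  ... | inj₂ refl | inj₁ refl = mk⇔ (λ (l′ , _) → contradiction l′ (<-asym l)) (λ ())
  ... | inj₂ refl | inj₂ refl = mk⇔ (λ (l′ , _) → contradiction l′ (<-irrefl refl)) (λ ())

  module _ {T : Separated n} {R : Pred (Vector ℕ 2) 0ℓ} (r : Represents w T R) where

    notˢ-represents : Represents w (notˢ T) (¬_ ∘ R)
    notˢ-represents .diagonal-⇔ e       = ¬-cong-⇔ (diagonal-⇔ r e)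
    notˢ-represents .ordered-⇔ v e e′ l =
      ⇔-sym (negation-⇔ w (ordered T v)) ⇔-∘ ¬-cong-⇔ (ordered-⇔ r v e e′ l)

    somewhere-⇔ : ∀ v ρ → (∃[ i ] i < length w × R (updateAt ρ v (const i))) ⇔
                          (w , ρ (other v) ⊨TL somewhere v T)
    somewhere-⇔ v ρ = mk⇔ search found
      where
      j : ℕ
      j = ρ (other v)
      below : ∀ {i} → i < j → R (updateAt ρ v (const i)) ⇔ DisjunctionHolds w i j (ordered T v)
      below {i} = ordered-⇔ r v (update-same ρ i v) (update-other ρ i v)
      above : ∀ {i} → j < i →
              R (updateAt ρ v (const i)) ⇔ DisjunctionHolds w j i (ordered T (other v))
      above {i} = ordered-⇔ r (other v) (update-other ρ i v)
        (trans (cong (updateAt ρ v (const i)) (other-involutive v)) (update-same ρ i v))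
      search : (∃[ i ] i < length w × R (updateAt ρ v (const i))) → w , j ⊨TL somewhere v T
      search (i , i< , h) with <-cmp i j
      ... | tri< i<j _ _ = inj₁ (from (look-⇔ past w (ordered T v)) (i , i< , i<j , to (below i<j) h))
      ... | tri≈ _ i≡j _ = inj₂ (inj₁
        ( from (occupied-⇔ w) (subst (_< length w) i≡j i<)
        , to (diagonal-⇔ r (update-all ρ i v i≡j)) h))
      ... | tri> _ _ j<i = inj₂ (inj₂
        (from (look-⇔ future w (ordered T (other v))) (i , i< , j<i , to (above j<i) h)))
      found : w , j ⊨TL somewhere v T → ∃[ i ] i < length w × R (updateAt ρ v (const i))
      found (inj₁ h) =
        let i , i< , i<j , c = to (look-⇔ past w (ordered T v)) h in i , i< , from (below i<j) c
      found (inj₂ (inj₁ (o , h))) =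
        j , to (occupied-⇔ w) o , from (diagonal-⇔ r (update-all ρ j v refl)) h
      found (inj₂ (inj₂ h)) =
        let i , i< , j<i , c = to (look-⇔ future w (ordered T (other v))) h
        in i , i< , from (above j<i) c

    exˢ-represents : ∀ v → Represents w (exˢ v T)
      (λ ρ → ∃[ i ] i < length w × R (updateAt ρ v (const i)))
    exˢ-represents v = Represents-resp (somewhere-⇔ v) (unaryˢ-represents (other v) (somewhere v T))

    module _ {T′ : Separated n} {R′ : Pred (Vector ℕ 2) 0ℓ} (r′ : Represents w T′ R′) where

      ∧ˢ-represents : Represents w (T ∧ˢ T′) (λ ρ → R ρ × R′ ρ)
      ∧ˢ-represents .diagonal-⇔ e       = diagonal-⇔ r e ×-⇔ diagonal-⇔ r′ e
      ∧ˢ-represents .ordered-⇔ v e e′ l =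
        ⇔-sym (conjunction-⇔ w (ordered T v) (ordered T′ v)) ⇔-∘
        (ordered-⇔ r v e e′ l ×-⇔ ordered-⇔ r′ v e e′ l)

      ∨ˢ-represents : Represents w (T ∨ˢ T′) (λ ρ → R ρ ⊎ R′ ρ)
      ∨ˢ-represents .diagonal-⇔ e       = diagonal-⇔ r e ⊎-⇔ diagonal-⇔ r′ e
      ∨ˢ-represents .ordered-⇔ v e e′ l =
        ↔⇒⇔ Any.++↔ ⇔-∘ (ordered-⇔ r v e e′ l ⊎-⇔ ordered-⇔ r′ v e e′ l)

  separate-represents : ∀ φ → Represents w (separate φ) (λ ρ → w , ρ ⊨FO φ)
  separate-represents (u ≺ v) =
    Represents-resp (λ _ → mk⇔ (_, z≤n) proj₁) (binaryˢ-represents u v always)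
  separate-represents (letter a v) = unaryˢ-represents v (letter a)
  separate-represents (between (atLeast a k) u v) =
    Represents-resp (λ ρ → ⇔-id _ ×-⇔ ≡⇒ (cong (k ≤_) (countBetween-cong (ρ u) (ρ v))))
      (binaryˢ-represents u v (atom (# ⁅ a ⁆ ge k)))
    where
    countBetween-cong : ∀ i j → countBetween (Fin._≟ a) w i j ≡ countBetween (_∈? ⁅ a ⁆) w i j
    countBetween-cong i j = cong length
      (filter-agree (inside? future (Fin._≟ a) w i j) (inside? future (_∈? ⁅ a ⁆) w i j)
        (upTo (length w)) (All.universal (λ _ → ⇔-id _ ×-⇔ ⇔-id _ ×-⇔
          mk⇔ (Maybe.map (from x∈⁅y⁆⇔x≡y)) (Maybe.map (to x∈⁅y⁆⇔x≡y))) _))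
  separate-represents (not φ)   = notˢ-represents (separate-represents φ)
  separate-represents (φ ∧ ψ)   = ∧ˢ-represents (separate-represents φ) (separate-represents ψ)
  separate-represents (φ ∨ ψ)   = ∨ˢ-represents (separate-represents φ) (separate-represents ψ)
  separate-represents (ex v φ)  = exˢ-represents (separate-represents φ) v
  separate-represents (all v φ) = Represents-resp
    (λ ρ → mk⇔ (λ h (i , i< , ¬h) → ¬h (h i i<))
               (λ ¬∃ i i< → decidable-stable (satFO? w (updateAt ρ v (const i)) φ)
                              (λ ¬h → ¬∃ (i , i< , ¬h))))
    (notˢ-represents (exˢ-represents (notˢ-represents (separate-represents φ)) v))

-- From temporal logic to two-variable first-order logic

-- Quantified so as to be closed: a universal statement with a true body holds in every word, one
-- with a false body only in the empty word.
verum emptyWord : FO² n inv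
verum     = all zero (not (zero ≺ zero))
emptyWord = all zero (zero ≺ zero)

avoiding : Var → Var → List (Fin n) → FO² n inv
avoiding x y = foldr (λ a ψ → not (between (some a) x y) ∧ ψ) verum

avoiding-⇔ : ∀ {w : Word n} {ρ} x y as →
  (w , ρ ⊨FO avoiding x y as) ⇔ All (λ a → ¬ BetweenHolds (some a) w (ρ x) (ρ y)) as
avoiding-⇔ x y []       = mk⇔ (const []) (λ _ _ _ → <-irrefl refl)
avoiding-⇔ x y (a ∷ as) = mk⇔ (λ (h , hs) → h ∷ to (avoiding-⇔ x y as) hs)
                              (λ where (h ∷ hs) → h , from (avoiding-⇔ x y as) hs)

noneBetween : Subset n → Var → Var → FO² n inv
noneBetween B x y = avoiding x y (filter (_∈? B) (allFin _))

noneBetween-⇔ : ∀ (w : Word n) {ρ} B x y →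
  (w , ρ ⊨FO noneBetween B x y) ⇔ InvariantHolds w (ρ x) (ρ y) (# B ≡0)
noneBetween-⇔ w {ρ} B x y =
  Vacant⇔count≡0 future (_∈? B) w ⇔-∘ (mk⇔ vacate avoid ⇔-∘ avoiding-⇔ x y _)
  where
  Avoided : Set
  Avoided = All (λ a → ¬ BetweenHolds (some a) w (ρ x) (ρ y)) (filter (_∈? B) (allFin _))
  vacate : Avoided → Vacant future (_∈ B) w (ρ x) (ρ y)
  vacate avoided h@(x<k , k<y , p) =
    let a , wk≡a , a∈B = any⇒just p
    in All.lookup avoided (∈-filter⁺ (_∈? B) (∈-allFin a) a∈B)
         (_ , Inside⇒bounded future w h , x<k , k<y , wk≡a)
  avoid : Vacant future (_∈ B) w (ρ x) (ρ y) → Avoided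
  avoid vacant = All.map (λ a∈B (_ , _ , x<k , k<y , wk≡a) → vacant (x<k , k<y , just⇒any wk≡a a∈B))
                         (All.all-filter (_∈? B) (allFin _))

-- Two variables suffice because they alternate: the formula at the target has only `other x` free,
-- so `x` can be bound again inside it.
standard : Var → TL n Inv → FO² n inv
standard x ⊤             = not (x ≺ x)
standard x (letter a)    = letter a x
standard x (not φ)       = not (standard x φ)
standard x (φ ∧ ψ)       = standard x φ ∧ standard x ψ
standard x (φ ∨ ψ)       = standard x φ ∨ standard x ψ
standard x (F (# B ≡0) φ) =
  ex (other x) (x ≺ other x ∧ noneBetween B x (other x) ∧ standard (other x) φ)
standard x (P (# B ≡0) φ) =
  ex (other x) (other x ≺ x ∧ noneBetween B (other x) x ∧ standard (other x) φ)

standard-⇔ : ∀ (w : Word n) φ x ρ → (w , ρ x ⊨TL φ) ⇔ (w , ρ ⊨FO standard x φ)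
standard-⇔ w ⊤          x ρ = mk⇔ (λ _ → <-irrefl refl) (const tt)
standard-⇔ w (letter a) x ρ = ⇔-id _
standard-⇔ w (not φ)    x ρ = ¬-cong-⇔ (standard-⇔ w φ x ρ)
standard-⇔ w (φ ∧ ψ)    x ρ = standard-⇔ w φ x ρ ×-⇔ standard-⇔ w ψ x ρ
standard-⇔ w (φ ∨ ψ)    x ρ = standard-⇔ w φ x ρ ⊎-⇔ standard-⇔ w ψ x ρ
standard-⇔ w (F (# B ≡0) φ) x ρ = position-cong w λ j →
  let ρ′ = updateAt ρ (other x) (const j)
      x≡ = sym (update-other′ ρ j x)
      y≡ = sym (update-same ρ j (other x))
  in ≡⇒ (cong₂ _<_ x≡ y≡)
     ×-⇔ (⇔-sym (noneBetween-⇔ w {ρ′} B x (other x)) ⇔-∘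
          ≡⇒ (cong₂ (λ i j → InvariantHolds w i j (# B ≡0)) x≡ y≡))
     ×-⇔ (standard-⇔ w φ (other x) ρ′ ⇔-∘ ≡⇒ (cong (w ,_⊨TL φ) y≡))
standard-⇔ w (P (# B ≡0) φ) x ρ = position-cong w λ j →
  let ρ′ = updateAt ρ (other x) (const j)
      x≡ = sym (update-other′ ρ j x)
      y≡ = sym (update-same ρ j (other x))
  in ≡⇒ (cong₂ _<_ y≡ x≡)
     ×-⇔ (⇔-sym (noneBetween-⇔ w {ρ′} B (other x) x) ⇔-∘
          ≡⇒ (cong₂ (λ i j → InvariantHolds w i j (# B ≡0)) y≡ x≡))
     ×-⇔ (standard-⇔ w φ (other x) ρ′ ⇔-∘ ≡⇒ (cong (w ,_⊨TL φ) y≡))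

≢other⇒≡ : ∀ {x v} → v ≢ other x → v ≡ x
≢other⇒≡ {x} {v} v≢ = [ id , (λ v≡ → contradiction v≡ v≢) ]′ (same-or-other v x)

Free-standard : ∀ x (φ : TL n Inv) {v} → Free (standard x φ) v → v ≡ x
Free-standard x ⊤             = [ id , id ]′
Free-standard x (letter a)    = id
Free-standard x (not φ)       = Free-standard x φ
Free-standard x (φ ∧ ψ)       = [ Free-standard x φ , Free-standard x ψ ]′
Free-standard x (φ ∨ ψ)       = [ Free-standard x φ , Free-standard x ψ ]′
Free-standard x (F (# B ≡0) φ) = ≢other⇒≡ ∘ proj₁
Free-standard x (P (# B ≡0) φ) = ≢other⇒≡ ∘ proj₁

-- The first disjunct fails in the empty word, where the second one supplies the
-- value of φ; on other words the second one is false.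
closure : TL n Inv → FO² n inv
closure φ = ex zero (not (ex (suc zero) (suc zero ≺ zero)) ∧ standard zero φ)
          ∨ (if does (sat? [] 0 φ) then emptyWord else not verum)

Free-closure : ∀ (φ : TL n Inv) → Empty (Free (closure φ))
Free-closure φ v (inj₁ (v≢0 , inj₁ (v≢1 , inj₁ v≡1))) = v≢1 v≡1
Free-closure φ v (inj₁ (v≢0 , inj₁ (v≢1 , inj₂ v≡0))) = v≢0 v≡0
Free-closure φ v (inj₁ (v≢0 , inj₂ h)) = v≢0 (Free-standard zero φ h)
Free-closure φ v (inj₂ h) with does (sat? [] 0 φ)
Free-closure φ v (inj₂ (v≢0 , h)) | true  = [ v≢0 , v≢0 ]′ h
Free-closure φ v (inj₂ (v≢0 , h)) | false = [ v≢0 , v≢0 ]′ h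

closure-⇔ : ∀ (φ : TL n Inv) w ρ → (w , 0 ⊨TL φ) ⇔ (w , ρ ⊨FO closure φ)
closure-⇔ φ [] ρ with sat? [] 0 φ
... | yes h = mk⇔ (λ _ → inj₂ λ _ ()) (const h)
... | no ¬h = mk⇔ (λ h → contradiction h ¬h)
                  λ where (inj₂ ¬v) → contradiction (λ _ _ → <-irrefl refl) ¬v
closure-⇔ φ w@(_ ∷ _) ρ = mk⇔
  (λ h → inj₁ (0 , s≤s z≤n , (λ ()) , to (standard-⇔ w φ zero (updateAt ρ zero (const 0))) h))
  λ where
    (inj₁ (zero  , _ , _ , h)) → from (standard-⇔ w φ zero (updateAt ρ zero (const 0))) h
    -- Position 0 precedes this one, contrary to its being first.
    (inj₁ (suc _ , _ , first , _)) → contradiction (0 , s≤s z≤n , s≤s z≤n) first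
    (inj₂ h) → contradiction h notEmpty
  where
  notEmpty : ¬ (w , ρ ⊨FO (if does (sat? [] 0 φ) then emptyWord else not verum))
  notEmpty h with does (sat? [] 0 φ)
  ... | true  = contradiction (h 0 (s≤s z≤n)) (<-irrefl refl)
  ... | false = h (λ _ _ → <-irrefl refl)

-- From invariant to threshold predicates

counting : FO² n inv → FO² n th
counting (u ≺ v)                  = u ≺ v
counting (letter a v)             = letter a v
counting (between (some a) u v)   = between (atLeast a 1) u v
counting (not φ)                  = not (counting φ)
counting (φ ∧ ψ)                  = counting φ ∧ counting ψ
counting (φ ∨ ψ)                  = counting φ ∨ counting ψ
counting (ex v φ)                 = ex v (counting φ)
counting (all v φ)                = all v (counting φ)

Free-counting : ∀ (φ : FO² n inv) {v} → Free (counting φ) v → Free φ v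
Free-counting (u ≺ v)                = id
Free-counting (letter a v)           = id
Free-counting (between (some a) u v) = id
Free-counting (not φ)                = Free-counting φ
Free-counting (φ ∧ ψ)                = Sum.map (Free-counting φ) (Free-counting ψ)
Free-counting (φ ∨ ψ)                = Sum.map (Free-counting φ) (Free-counting ψ)
Free-counting (ex v φ)               = map₂ (Free-counting φ)
Free-counting (all v φ)              = map₂ (Free-counting φ)

some⇔atLeast-1 : ∀ (w : Word n) a i j →
  BetweenHolds (some a) w i j ⇔ BetweenHolds (atLeast a 1) w i j
some⇔atLeast-1 w a i j = mk⇔
  (λ (k , _ , i<k , k<j , wk≡a) → <-trans i<k k<j ,
    n≢0⇒n>0 (λ none → from (Vacant⇔count≡0 future (Fin._≟ a) w) none (i<k , k<j , just⇒any wk≡a refl)))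
  λ (_ , count>0) → witness count>0
  where
  witness : 1 ≤ countBetween (Fin._≟ a) w i j → BetweenHolds (some a) w i j
  witness count>0 with anyUpTo? (inside? future (Fin._≟ a) w i j) (length w)
  ... | yes (k , k< , i<k , k<j , p) with any⇒just p
  ...   | _ , wk≡a , refl = k , k< , i<k , k<j , wk≡a
  witness count>0 | no none = contradiction
    (to (Vacant⇔count≡0 future (Fin._≟ a) w) (λ h → none (_ , Inside⇒bounded future w h , h)))
    (n>0⇒n≢0 count>0)

counting-⇔ : ∀ (w : Word n) φ ρ → (w , ρ ⊨FO φ) ⇔ (w , ρ ⊨FO counting φ)
counting-⇔ w (u ≺ v)                ρ = ⇔-id _
counting-⇔ w (letter a v)           ρ = ⇔-id _
counting-⇔ w (between (some a) u v) ρ = some⇔atLeast-1 w a (ρ u) (ρ v)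
counting-⇔ w (not φ)                ρ = ¬-cong-⇔ (counting-⇔ w φ ρ)
counting-⇔ w (φ ∧ ψ)                ρ = counting-⇔ w φ ρ ×-⇔ counting-⇔ w ψ ρ
counting-⇔ w (φ ∨ ψ)                ρ = counting-⇔ w φ ρ ⊎-⇔ counting-⇔ w ψ ρ
counting-⇔ w (ex v φ)               ρ = position-cong w (λ i → counting-⇔ w φ _)
counting-⇔ w (all v φ)              ρ = mk⇔ (λ h i i< → to (counting-⇔ w φ _) (h i i<))
                                            (λ h i i< → from (counting-⇔ w φ _) (h i i<))

-- Comparison of the logics

infix 4 _⊢_≼_

record _⊢_≼_ (n : ℕ) (ℒ₁ ℒ₂ : Logic) : Set where
  constructor rewriting
  field
    rewrite-as : ∀ φ → ∃[ ψ ] ∀ w → language {n} ℒ₁ φ w ⇔ language {n} ℒ₂ ψ w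
open _⊢_≼_

≼-refl : ∀ {ℒ} → n ⊢ ℒ ≼ ℒ
≼-refl = rewriting λ φ → φ , λ w → ⇔-id _

≼-trans : ∀ {ℒ₁ ℒ₂ ℒ₃} → n ⊢ ℒ₁ ≼ ℒ₂ → n ⊢ ℒ₂ ≼ ℒ₃ → n ⊢ ℒ₁ ≼ ℒ₃
≼-trans f g = rewriting λ φ →
  let ψ , φ⇔ψ = rewrite-as f φ
      χ , ψ⇔χ = rewrite-as g ψ
  in χ , λ w → ψ⇔χ w ⇔-∘ φ⇔ψ w

≼⇒⊆ : ∀ {ℒ₁ ℒ₂} → n ⊢ ℒ₁ ≼ ℒ₂ → Definable n ℒ₁ ⊆ Definable n ℒ₂
≼⇒⊆ f (φ , L⊆ , ⊆L) =
  let ψ , φ⇔ψ = rewrite-as f φ in ψ , to (φ⇔ψ _) ∘ L⊆ , ⊆L ∘ from (φ⇔ψ _)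

Inv≼Th : n ⊢ TL[Inv] ≼ TL[Th]
Inv≼Th = rewriting λ φ → translate φ , λ w → translate-⇔ φ
  where open GuardMap {κ = Inv} {κ′ = Th} toThreshold (λ _ → ⇔-id _)

Inv≼BInv : n ⊢ TL[Inv] ≼ TL[BInv]
Inv≼BInv = rewriting λ φ → translate φ , λ w → translate-⇔ φ
  where open GuardMap {κ = Inv} {κ′ = BInv} atom (λ _ → ⇔-id _)

Th≼BTh : n ⊢ TL[Th] ≼ TL[BTh]
Th≼BTh = rewriting λ φ → translate φ , λ w → translate-⇔ φ
  where open GuardMap {κ = Th} {κ′ = BTh} atom (λ _ → ⇔-id _)

BInv≼BTh : n ⊢ TL[BInv] ≼ TL[BTh]
BInv≼BTh = rewriting λ φ → translate φ , λ w → translate-⇔ φ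
  where open GuardMap {κ = BInv} {κ′ = BTh} (mapᴮ toThreshold) (λ g → ⟦mapᴮ⟧ toThreshold g)

BTh≼Inv : n ⊢ TL[BTh] ≼ TL[Inv]
BTh≼Inv = rewriting λ φ → translate φ , λ w → translate-⇔ φ
  where open Translation {κ = BTh} {κ′ = Inv}
               (λ d g φ → Reach.invariantModality d φ g)
               (λ d g φ → Reach.invariantModality-⇔ d φ g)

Inv≼FOInv : n ⊢ TL[Inv] ≼ FO²[<,Inv]
Inv≼FOInv = rewriting λ φ → (closure φ , Free-closure φ) , λ w → closure-⇔ φ w _

FOInv≼FOTh : n ⊢ FO²[<,Inv] ≼ FO²[<,Th]
FOInv≼FOTh = rewriting λ (φ , closed) →
  (counting φ , λ v → closed v ∘ Free-counting φ) , λ w → counting-⇔ w φ _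

FOTh≼BTh : n ⊢ FO²[<,Th] ≼ TL[BTh]
-- Sentences are evaluated with both variables at 0, where the diagonal formula applies.
FOTh≼BTh = rewriting λ (φ , _) → diagonal (separate φ) , λ w →
  diagonal-⇔ (separate-represents φ) (λ _ → refl)

-- `TL[Inv]` is the hub: any two logics are compared by passing through it.
≼Inv : ∀ ℒ → n ⊢ ℒ ≼ TL[Inv]
≼Inv TL[Th]     = ≼-trans Th≼BTh BTh≼Inv
≼Inv TL[BTh]    = BTh≼Inv
≼Inv TL[Inv]    = ≼-refl
≼Inv TL[BInv]   = ≼-trans BInv≼BTh BTh≼Inv
≼Inv FO²[<,Th]  = ≼-trans FOTh≼BTh BTh≼Inv
≼Inv FO²[<,Inv] = ≼-trans FOInv≼FOTh (≼-trans FOTh≼BTh BTh≼Inv)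

Inv≼ : ∀ ℒ → n ⊢ TL[Inv] ≼ ℒ
Inv≼ TL[Th]     = Inv≼Th
Inv≼ TL[BTh]    = ≼-trans Inv≼Th Th≼BTh
Inv≼ TL[Inv]    = ≼-refl
Inv≼ TL[BInv]   = Inv≼BInv
Inv≼ FO²[<,Th]  = ≼-trans Inv≼FOInv FOInv≼FOTh
Inv≼ FO²[<,Inv] = Inv≼FOInv

theorem2 : (n : ℕ) (ℒ₁ ℒ₂ : Logic) → Definable n ℒ₁ ≐ Definable n ℒ₂
theorem2 n ℒ₁ ℒ₂ = ≼⇒⊆ (≼-trans (≼Inv ℒ₁) (Inv≼ ℒ₂)) , ≼⇒⊆ (≼-trans (≼Inv ℒ₂) (Inv≼ ℒ₁))
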